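{- For every even integer $n \geq 16$, there exists a connected cubic graph of order $n$ that admits a non-equitable $4$-total coloring.
   Context: All graphs are finite, simple and cubic ($3$-regular). The order of a graph is its number of vertices. A $4$-total coloring of $G$ assigns one of the four colors $1,2,3,4$ to each vertex and each edge of $G$ so that adjacent vertices receive distinct colors, adjacent edges (edges sharing an endpoint) receive distinct colors, and every vertex and edge that are incident receive distinct colors. The color class $c_i$ is the set of all vertices and edges of color $i$. The coloring is equitable if $\bigl||c_i|-|c_j|\bigr| \le 1$ for all $i,j \in \{1,2,3,4\}$, and non-equitable otherwise. -}

module Defs where

open import Data.Fin using (Fin; _<_)
open import Data.Fin.Properties using (_≟_; _<?_)
open import Data.List using (List; length; filter; map; mapMaybe; allFin; cartesianProduct; _++_)
open import Data.Maybe using (Maybe; just; nothing)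
open import Data.Nat using (ℕ; _≤_; ∣_-_∣)
open import Data.Product using (∃; _×_; uncurry)
open import Data.Sum using (_⊎_; inj₁; inj₂)
open import Level using (0ℓ)
open import Relation.Binary using (Rel; Decidable; Symmetric)
open import Relation.Binary.Construct.Closure.ReflexiveTransitive using (Star)
open import Relation.Binary.PropositionalEquality using (_≡_; _≢_)
open import Relation.Nullary using (¬_; yes; no)

record Graph (n : ℕ) : Set₁ where
  infix 4 _~_ _~?_
  field
    _~_    : Rel (Fin n) 0ℓ
    _~?_   : Decidable _~_
    ~-sym  : Symmetric _~_
    ~-irrefl : ∀ {v} → ¬ (v ~ v)

module _ {n : ℕ} (G : Graph n) where
  open Graph G

  degree : Fin n → ℕ
  degree v = length (filter (v ~?_) (allFin n))

  Cubic : Set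
  Cubic = ∀ v → degree v ≡ 3

  Connected : Set
  Connected = ∀ u v → Star _~_ u v

  -- The unordered pair {u , v} is stored with its smaller endpoint first, and
  -- the proofs are irrelevant, so an edge is determined by its two endpoints.
  record Edge : Set where
    constructor edge
    field
      fst snd   : Fin n
      .ordered  : fst < snd
      .adjacent : fst ~ snd

  Element : Set
  Element = Fin n ⊎ Edge

  edgeBetween : Fin n → Fin n → Maybe Edge
  edgeBetween u v with u <? v | u ~? v
  ... | yes u<v | yes u~v = just (edge u v u<v u~v)
  ... | yes _   | no _    = nothing
  ... | no _    | _       = nothing

  -- Every edge occurs exactly once, since edgeBetween u v fails unless u < v.
  edges : List Edge
  edges = mapMaybe (uncurry edgeBetween) (cartesianProduct (allFin n) (allFin n))

  elements : List Element
  elements = map inj₁ (allFin n) ++ map inj₂ edges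

module _ {n : ℕ} {G : Graph n} where

  infix 4 _∈ₑ_
  _∈ₑ_ : Fin n → Edge G → Set
  v ∈ₑ e = v ≡ Edge.fst e ⊎ v ≡ Edge.snd e

  AdjacentEdges : Rel (Edge G) 0ℓ
  AdjacentEdges e f = e ≢ f × ∃ λ v → v ∈ₑ e × v ∈ₑ f

record TotalColoring (k : ℕ) {n : ℕ} (G : Graph n) : Set where
  open Graph G
  field
    color : Element G → Fin k
    vertex-vertex : ∀ {u v} → u ~ v → color (inj₁ u) ≢ color (inj₁ v)
    edge-edge     : ∀ {e f} → AdjacentEdges e f → color (inj₂ e) ≢ color (inj₂ f)
    vertex-edge   : ∀ {v e} → v ∈ₑ e → color (inj₁ v) ≢ color (inj₂ e)

module _ {k n : ℕ} {G : Graph n} (c : TotalColoring k G) where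
  open TotalColoring c

  colorClass : Fin k → List (Element G)
  colorClass i = filter (λ x → color x ≟ i) (elements G)

  Equitable : Set
  Equitable = ∀ i j → ∣ length (colorClass i) - length (colorClass j) ∣ ≤ 1

{-# OPTIONS --safe #-}
-- Encode a 4-total coloring of a cubic graph by four involutions μ i of the vertex set: μ i v is the
-- other end of the edge of color i at v, and μ i v ≡ v if the vertex v itself has color i.  Then
-- 2 |cᵢ| = n + vᵢ, where vᵢ counts the vertices of color i, so it suffices to find v₀ ≥ v₃ + 4.
-- Cutting an edge of color 0 and joining its halves to a fixed 6-vertex block raises the order by 6
-- and v₀ - v₃ by 2.  The block again contains an edge of color 0 whose ends have the same colors
-- as those of the cut edge, so the step can be repeated, starting from colorings of orders 6, 8 and 10.
module Submission where

open import Defs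
open import Data.Empty using (⊥-elim)
open import Data.Fin as Fin using (Fin; zero; suc; _↑ˡ_; _↑ʳ_; splitAt)
open import Data.Fin.Induction using (<-wellFounded)
open import Data.Fin.Patterns
open import Data.Fin.Properties using (_≟_; _<?_; <-cmp; <-asym; <-irrefl; all?; any?; ↑ʳ-injective; splitAt-↑ˡ)
open import Data.List using (List; []; _∷_; length; filter; map; mapMaybe; allFin; cartesianProduct; tabulate; _++_)
open import Data.List.Membership.Propositional using (_∈_)
open import Data.List.Membership.Propositional.Properties
  using (∈-allFin; ∈-filter⁺; ∈-filter⁻; ∈-map∘filter⁺; ∈-map∘filter⁻; ∈-cartesianProduct⁺)
open import Data.List.Membership.Propositional.Properties.WithK using (unique∧set⇒bag)
open import Data.List.Properties
  using (length-map; length-++; length-tabulate; map-tabulate; filter-++; filter-≐; filter-accept; filter-reject)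
open import Data.List.Relation.Binary.BagAndSetEquality using (∼bag⇒↭)
open import Data.List.Relation.Binary.Permutation.Propositional.Properties using (↭-length)
open import Data.List.Relation.Unary.Unique.Propositional using (Unique)
open import Data.List.Relation.Unary.Unique.Propositional.Properties
  using (map⁺; filter⁺; allFin⁺; cartesianProduct⁺)
open import Data.Maybe using (Maybe; just; nothing)
open import Data.Maybe.Relation.Unary.Any as Any using (Any; just)
open import Data.Nat using (ℕ; zero; suc; _+_; _*_; _≤_)
open import Data.Nat.Divisibility using (_∣_; divides)
open import Data.Nat.Properties
  using (≤-refl; ≤-trans; +-suc; +-comm; +-monoʳ-≤; +-monoˡ-≤;
         +-monoʳ-<; *-cancelˡ-≤; *-cancelʳ-≤; n≮n; m≤n+m; m≤n⇒∃[o]m+o≡n; m≤n+∣m-n∣;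
         module ≤-Reasoning)
open import Data.Nat.Tactic.RingSolver using (solve-∀)
open import Data.Product using (Σ; ∃; _×_; _,_; proj₁; proj₂; uncurry)
open import Data.Sum using (_⊎_; inj₁; inj₂; [_,_]′)
open import Data.Vec as Vec using (Vec; []; _∷_; lookup)
open import Function using (_∘_; id; _⇔_; mk⇔)
open import Induction.WellFounded using (Acc; acc)
open import Relation.Binary using (Tri; tri<; tri≈; tri>)
open import Relation.Binary.Construct.Closure.ReflexiveTransitive using (Star; ε; _◅_; _◅◅_; reverse)
open import Relation.Binary.PropositionalEquality
  using (_≡_; _≢_; refl; sym; trans; cong; cong₂; subst; module ≡-Reasoning)
open import Relation.Nullary using (¬_; Dec; yes; no; contradiction; ¬?)
open import Relation.Nullary.Decidable
  using (_×-dec_; _⊎-dec_; _→-dec_; map′; from-yes; recompute; True; toWitness)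
open import Relation.Unary using (Decidable)

-- Counting in filtered lists.

module _ {A B : Set} {P : B → Set} (P? : Decidable P) where

  length-filter-map : (f : A → B) (xs : List A) →
    length (filter P? (map f xs)) ≡ length (filter (P? ∘ f) xs)
  length-filter-map f []       = refl
  length-filter-map f (x ∷ xs) with P? (f x)
  ... | yes _ = cong suc (length-filter-map f xs)
  ... | no  _ = length-filter-map f xs

  length-filter-mapMaybe : (f : A → Maybe B) (xs : List A) →
    length (filter P? (mapMaybe f xs)) ≡ length (filter (Any.dec P? ∘ f) xs)
  length-filter-mapMaybe f []       = refl
  length-filter-mapMaybe f (x ∷ xs) with f x
  ... | nothing = length-filter-mapMaybe f xs
  ... | just y with P? y
  ...   | yes _ = cong suc (length-filter-mapMaybe f xs)
  ...   | no  _ = length-filter-mapMaybe f xs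

length-filter-tabulate : ∀ {A : Set} {P : A → Set} (P? : Decidable P) {n} (f : Fin n → A) →
  length (filter P? (tabulate f)) ≡ length (filter (P? ∘ f) (allFin n))
length-filter-tabulate P? {n} f =
  trans (cong (length ∘ filter P?) (sym (map-tabulate id f))) (length-filter-map P? f (allFin n))

length-filter-tri : ∀ {A : Set} {P Q R : A → Set}
  (P? : Decidable P) (Q? : Decidable Q) (R? : Decidable R) →
  (∀ x → Tri (P x) (Q x) (R x)) → (xs : List A) →
  length (filter P? xs) + length (filter Q? xs) + length (filter R? xs) ≡ length xs
length-filter-tri P? Q? R? tri []       = refl
length-filter-tri P? Q? R? tri (x ∷ xs) with tri x | length-filter-tri P? Q? R? tri xs
... | tri< p ¬q ¬r | ih
  rewrite filter-accept P? {xs = xs} p | filter-reject Q? {xs = xs} ¬q | filter-reject R? {xs = xs} ¬r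
  = cong suc ih
... | tri≈ ¬p q ¬r | ih
  rewrite filter-reject P? {xs = xs} ¬p | filter-accept Q? {xs = xs} q | filter-reject R? {xs = xs} ¬r
        | +-suc (length (filter P? xs)) (length (filter Q? xs))
  = cong suc ih
... | tri> ¬p ¬q r | ih
  rewrite filter-reject P? {xs = xs} ¬p | filter-reject Q? {xs = xs} ¬q | filter-accept R? {xs = xs} r
  = trans (+-suc _ _) (cong suc ih)

-- Without repetitions, equality as sets is equality as bags, so the lists are permutations of each
-- other.
length-unique-set : ∀ {A : Set} {xs ys : List A} → Unique xs → Unique ys →
  (∀ {x} → x ∈ xs ⇔ x ∈ ys) → length xs ≡ length ys
length-unique-set xs! ys! eq = ↭-length (∼bag⇒↭ (unique∧set⇒bag xs! ys! eq))

length-filter-bij : ∀ {A B : Set} {P : A → Set} {Q : B → Set} (P? : Decidable P) (Q? : Decidable Q)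
  (f : A → B) {xs : List A} {ys : List B} → Unique xs → Unique ys →
  (∀ {x y} → f x ≡ f y → x ≡ y) → (∀ x → x ∈ xs) → (∀ y → y ∈ ys) →
  (∀ x → P x → Q (f x)) → (∀ y → Q y → ∃ λ x → y ≡ f x × P x) →
  length (filter P? xs) ≡ length (filter Q? ys)
length-filter-bij {Q = Q} P? Q? f {xs} {ys} xs! ys! inj ∈xs ∈ys to from =
  trans (sym (length-map f (filter P? xs)))
    (length-unique-set (map⁺ inj (filter⁺ P? xs!)) (filter⁺ Q? ys!) (mk⇔
      (λ y∈ → let x , _ , y≡fx , px = ∈-map∘filter⁻ f P? {f} {xs} y∈
              in ∈-filter⁺ Q? (∈ys _) (subst Q (sym y≡fx) (to x px)))
      (λ y∈ → let x , y≡fx , px = from _ (proj₂ (∈-filter⁻ Q? {xs = ys} y∈))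
              in ∈-map∘filter⁺ f P? {f} (x , ∈xs x , y≡fx , px))))

-- Splits a claim about an extended scheme into block vertices, where evaluation can decide it, and
-- old vertices, where the given scheme proves it.
+-elim : ∀ m {n} (P : Fin (m + n) → Set) →
  (∀ i → P (i ↑ˡ n)) → (∀ j → P (m ↑ʳ j)) → ∀ k → P k
+-elim zero    P l r k       = r k
+-elim (suc m) P l r zero    = l zero
+-elim (suc m) P l r (suc k) = +-elim m (P ∘ suc) (l ∘ suc) r k

-- Colorings encoded by four involutions.

colorCount : ∀ {n} → (Fin n → Fin 4) → Fin 4 → ℕ
colorCount col i = length (filter (λ v → col v ≟ i) (allFin _))

-- The last three fields fix the edge at which the coloring will be extended.
record IsScheme {k : ℕ} (μ : Fin 4 → Fin (2 + k) → Fin (2 + k)) (col : Fin (2 + k) → Fin 4) : Set where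
  field
    involutive : ∀ i v → μ i (μ i v) ≡ v
    fixed      : ∀ v → μ (col v) v ≡ v
    distinct   : ∀ v i j → μ i v ≡ μ j v → i ≡ j
    proper     : ∀ v i → col (μ i v) ≡ col v → i ≡ col v
    descends   : ∀ v → ∃ λ i → μ i (suc v) Fin.< suc v
    edge01     : μ 0F 0F ≡ 1F
    col0       : col 0F ≡ 1F
    col1       : col 1F ≡ 2F

-- All conditions quantify over finite types only, so a concrete table can be validated by
-- evaluation.
isScheme? : ∀ {k} μ col → Dec (IsScheme {k} μ col)
isScheme? μ col = map′
  (λ (a , b , c , d , e , f , g , h) → record
    { involutive = a ; fixed = b ; distinct = c ; proper = d
    ; descends = e ; edge01 = f ; col0 = g ; col1 = h })
  (λ S → let open IsScheme S in
    involutive , fixed , distinct , proper , descends , edge01 , col0 , col1)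
  ( (all? λ i → all? λ v → μ i (μ i v) ≟ v)
  ×-dec (all? λ v → μ (col v) v ≟ v)
  ×-dec (all? λ v → all? λ i → all? λ j → (μ i v ≟ μ j v) →-dec (i ≟ j))
  ×-dec (all? λ v → all? λ i → (col (μ i v) ≟ col v) →-dec (i ≟ col v))
  ×-dec (all? λ v → any? λ i → μ i (suc v) <? suc v)
  ×-dec (μ 0F 0F ≟ 1F) ×-dec (col 0F ≟ 1F) ×-dec (col 1F ≟ 2F))

record Scheme (k : ℕ) : Set where
  field
    μ        : Fin 4 → Fin (2 + k) → Fin (2 + k)
    col      : Fin (2 + k) → Fin 4
    isScheme : IsScheme μ col
  open IsScheme isScheme public

-- The connected cubic graph of a scheme and its 4-total coloring.

module Coloring {k : ℕ} (S : Scheme k) where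
  open Scheme S

  n : ℕ
  n = 2 + k

  fixed⇒col : ∀ {i v} → μ i v ≡ v → i ≡ col v
  fixed⇒col {i} {v} eq = distinct v i (col v) (trans eq (sym (fixed v)))

  μ-injective : ∀ i {u v} → μ i u ≡ μ i v → u ≡ v
  μ-injective i eq = trans (sym (involutive i _)) (trans (cong (μ i) eq) (involutive i _))

  μ-swap : ∀ {i u v} → μ i u ≡ v → μ i v ≡ u
  μ-swap {i} {u} eq = trans (cong (μ i) (sym eq)) (involutive i u)

  _~_ : Fin n → Fin n → Set
  u ~ v = u ≢ v × ∃ λ i → μ i u ≡ v

  graph : Graph n
  graph = record
    { _~_      = _~_
    ; _~?_     = λ u v → ¬? (u ≟ v) ×-dec any? (λ i → μ i u ≟ v)
    ; ~-sym    = λ (u≢v , i , eq) → u≢v ∘ sym , i , μ-swap eq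
    ; ~-irrefl = λ (v≢v , _) → v≢v refl
    }

  open Graph graph using (_~?_; ~-sym)

  -- By `descends`, every nonzero vertex has a smaller neighbor; well-founded descent can only stop
  -- at `0F`.
  path-to-zero : ∀ v → Acc Fin._<_ v → Star _~_ v 0F
  path-to-zero zero    _         = ε
  path-to-zero (suc v) (acc rec) =
    let i , lt = descends v
    in ((λ eq → <-irrefl (sym eq) lt) , i , refl) ◅ path-to-zero (μ i (suc v)) (rec lt)

  connected : Connected graph
  connected u v = path u ◅◅ reverse ~-sym (path v)
    where path = λ w → path-to-zero w (<-wellFounded w)

  -- At `v` the four involutions take distinct values and only the one of color `col v` fixes `v`,
  -- so the other three colors biject with the neighbors.
  cubic : Cubic graph
  cubic v = trans
    (sym (length-filter-bij (λ i → ¬? (i ≟ col v)) (v ~?_) (λ i → μ i v) (allFin⁺ 4) (allFin⁺ n)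
      (distinct v _ _) ∈-allFin ∈-allFin
      (λ i i≢ → (λ eq → i≢ (fixed⇒col (sym eq))) , i , refl)
      (λ w (v≢w , i , eq) → i , sym eq ,
        λ i≡ → v≢w (trans (sym (fixed v)) (trans (cong (λ j → μ j v) (sym i≡)) eq)))))
    (three (col v))
    where
    three : ∀ c → length (filter (λ i → ¬? (i ≟ c)) (allFin 4)) ≡ 3
    three 0F = refl
    three 1F = refl
    three 2F = refl
    three 3F = refl

  -- The fields of an edge are irrelevant proofs; decidability of the order, and below of adjacency,
  -- makes them usable again.
  fst<snd : (e : Edge graph) → Edge.fst e Fin.< Edge.snd e
  fst<snd (edge u v u<v _) = recompute (u <? v) u<v

  fst~snd : (e : Edge graph) → Edge.fst e ~ Edge.snd e
  fst~snd (edge u v _ u~v) = recompute (u ~? v) u~v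

  module _ (e : Edge graph) where
    open Edge e

    -- The color is a component of the adjacency proof; by `distinct` no other color joins the same
    -- two ends.
    edgeColor : Fin 4
    edgeColor = proj₁ (proj₂ (fst~snd e))

    μ-edge : μ edgeColor fst ≡ snd
    μ-edge = proj₂ (proj₂ (fst~snd e))

    col≢edgeColor : ∀ {v} → v ∈ₑ e → col v ≢ edgeColor
    col≢edgeColor {v} v∈e eq = proj₁ (fst~snd e) (ends v∈e (trans (cong (λ i → μ i v) (sym eq)) (fixed v)))
      where
      ends : v ∈ₑ e → μ edgeColor v ≡ v → fst ≡ snd
      ends (inj₁ refl) fix = trans (sym fix) μ-edge
      ends (inj₂ refl) fix = trans (sym (μ-swap μ-edge)) fix

  edge-≡ : ∀ {e f : Edge graph} → Edge.fst e ≡ Edge.fst f → Edge.snd e ≡ Edge.snd f → e ≡ f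
  edge-≡ refl refl = refl

  -- The involution of the common color determines the other end from `v`. If `v` were the smaller
  -- end of one edge and the larger end of the other, the ends would be crossed, against the order
  -- in which they are stored.
  edgeColor-injective : ∀ e f {v} → v ∈ₑ e → v ∈ₑ f → edgeColor e ≡ edgeColor f → e ≡ f
  edgeColor-injective e f v∈e v∈f eq = go v∈e v∈f
    where
    μf : μ (edgeColor e) (Edge.fst f) ≡ Edge.snd f
    μf = trans (cong (λ i → μ i (Edge.fst f)) eq) (μ-edge f)

    crossed : Edge.fst e ≡ Edge.snd f → Edge.fst f ≢ Edge.snd e
    crossed p q = <-asym (fst<snd f) (subst (Fin._< Edge.fst f) p (subst (Edge.fst e Fin.<_) (sym q) (fst<snd e)))

    go : ∀ {v} → v ∈ₑ e → v ∈ₑ f → e ≡ f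
    go (inj₁ refl) (inj₁ p) = edge-≡ p (trans (sym (μ-edge e)) (trans (cong (μ _) p) μf))
    go (inj₂ refl) (inj₂ p) = edge-≡ (μ-injective _ (trans (μ-edge e) (trans p (sym μf)))) p
    go (inj₁ refl) (inj₂ p) =
      ⊥-elim (crossed p (trans (sym (μ-swap μf)) (trans (cong (μ _) (sym p)) (μ-edge e))))
    go (inj₂ refl) (inj₁ p) =
      ⊥-elim (crossed (trans (sym (μ-swap (μ-edge e))) (trans (cong (μ _) p) μf)) (sym p))

  coloring : TotalColoring 4 graph
  coloring = record
    { color         = λ { (inj₁ v) → col v ; (inj₂ e) → edgeColor e }
    ; vertex-vertex = λ { {u} (u≢v , i , refl) eq →
        u≢v (trans (sym (fixed u)) (cong (λ j → μ j u) (sym (proper u i (sym eq))))) }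
    ; edge-edge     = λ { {e} {f} (e≢f , v , v∈e , v∈f) eq → e≢f (edgeColor-injective e f v∈e v∈f eq) }
    ; vertex-edge   = λ {v} {e} → col≢edgeColor e
    }

  -- Sizes of the color classes.

  module _ (i : Fin 4) where

    -- Counts the edges of color `i`, each at its smaller end.
    ascents : ℕ
    ascents = length (filter (λ u → u <? μ i u) (allFin n))

    descents≡ascents : length (filter (λ u → μ i u <? u) (allFin n)) ≡ ascents
    descents≡ascents = length-filter-bij (λ u → μ i u <? u) (λ u → u <? μ i u) (μ i)
      (allFin⁺ n) (allFin⁺ n) (μ-injective i) ∈-allFin ∈-allFin
      (λ u lt → subst (μ i u Fin.<_) (sym (involutive i u)) lt)
      (λ u lt → μ i u , sym (involutive i u) , subst (Fin._< μ i u) (sym (involutive i u)) lt)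

    -- Trichotomy of `u` and `μ i u`: equality means that `u` has color `i`, and `μ i` exchanges the
    -- two strict cases.
    ascents+colorCount+ascents : ascents + colorCount col i + ascents ≡ n
    ascents+colorCount+ascents = begin
      ascents + colorCount col i + ascents
        ≡⟨ cong₂ (λ x y → ascents + x + y)
             (cong length (filter-≐ (λ v → col v ≟ i) (λ v → v ≟ μ i v)
               ( (λ { refl → sym (fixed _) }) , λ eq → sym (fixed⇒col (sym eq))) (allFin n)))
             (sym descents≡ascents) ⟩
      _ ≡⟨ length-filter-tri (λ u → u <? μ i u) (λ u → u ≟ μ i u) (λ u → μ i u <? u)
             (λ u → <-cmp u (μ i u)) (allFin n) ⟩
      length (allFin n) ≡⟨ length-tabulate id ⟩
      n ∎
      where open ≡-Reasoning

    HasColor : Maybe (Edge graph) → Set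
    HasColor = Any (λ e → edgeColor e ≡ i)

    hasColor? : Decidable HasColor
    hasColor? = Any.dec (λ e → edgeColor e ≟ i)

    edgeBetween⁺ : ∀ u → u Fin.< μ i u → HasColor (edgeBetween graph u (μ i u))
    edgeBetween⁺ u u<w with u <? μ i u | u ~? μ i u
    -- The decision procedure may have found its own witness color; `distinct` identifies it with
    -- `i`.
    ... | yes p | yes q = just (distinct u _ _ (μ-edge (edge u (μ i u) p q)))
    ... | yes p | no ¬q = contradiction ((λ eq → <-irrefl eq p) , i , refl) ¬q
    ... | no ¬p | _     = contradiction u<w ¬p

    edgeBetween⁻ : ∀ u w → HasColor (edgeBetween graph u w) → u Fin.< w × w ≡ μ i u
    edgeBetween⁻ u w h with u <? w | u ~? w | h
    ... | yes p | yes q | just refl = p , sym (μ-edge (edge u w p q))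

    edgeCount : length (filter (λ e → edgeColor e ≟ i) (edges graph)) ≡ ascents
    edgeCount = trans
      (length-filter-mapMaybe (λ e → edgeColor e ≟ i) (uncurry (edgeBetween graph))
        (cartesianProduct (allFin n) (allFin n)))
      (sym (length-filter-bij (λ u → u <? μ i u) (hasColor? ∘ uncurry (edgeBetween graph))
        (λ u → u , μ i u) (allFin⁺ n) (cartesianProduct⁺ (allFin⁺ n) (allFin⁺ n))
        (cong proj₁) ∈-allFin (λ _ → ∈-cartesianProduct⁺ (∈-allFin _) (∈-allFin _))
        edgeBetween⁺
        (λ (u , w) h → let u<w , w≡ = edgeBetween⁻ u w h
                       in u , cong (u ,_) w≡ , subst (u Fin.<_) w≡ u<w)))

    classSize : length (colorClass coloring i) ≡ colorCount col i + ascents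
    classSize = begin
      length (filter c? (map inj₁ (allFin n) ++ map inj₂ (edges graph)))
        ≡⟨ cong length (filter-++ c? (map inj₁ (allFin n)) _) ⟩
      length (filter c? (map inj₁ (allFin n)) ++ filter c? (map inj₂ (edges graph)))
        ≡⟨ length-++ (filter c? (map inj₁ (allFin n))) ⟩
      length (filter c? (map inj₁ (allFin n))) + length (filter c? (map inj₂ (edges graph)))
        ≡⟨ cong₂ _+_ (length-filter-map c? inj₁ (allFin n)) (length-filter-map c? inj₂ (edges graph)) ⟩
      colorCount col i + length (filter (λ e → edgeColor e ≟ i) (edges graph))
        ≡⟨ cong (colorCount col i +_) edgeCount ⟩
      colorCount col i + ascents ∎
      where
      open ≡-Reasoning
      c? : Decidable (λ x → TotalColoring.color coloring x ≡ i)
      c? x = TotalColoring.color coloring x ≟ i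

    double-classSize : 2 * length (colorClass coloring i) ≡ n + colorCount col i
    double-classSize = begin
      2 * length (colorClass coloring i)            ≡⟨ cong (2 *_) classSize ⟩
      2 * (colorCount col i + ascents)              ≡⟨ regroup (colorCount col i) ascents ⟩
      ascents + colorCount col i + ascents + colorCount col i
                                                    ≡⟨ cong (_+ colorCount col i) ascents+colorCount+ascents ⟩
      n + colorCount col i                          ∎
      where
      open ≡-Reasoning
      regroup : ∀ v a → 2 * (v + a) ≡ a + v + a + v
      regroup = solve-∀

  -- Class sizes differ by half the difference of the vertex counts, so a gap of 4 between the
  -- counts is a gap of 2 between the classes.
  gap⇒non-equitable : 4 + colorCount col 3F ≤ colorCount col 0F → ¬ Equitable coloring
  gap⇒non-equitable gap equitable = n≮n _ (begin-strict
    size 3F + 1                       <⟨ +-monoʳ-< (size 3F) {1} {2} ≤-refl ⟩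
    size 3F + 2                       ≡⟨ +-comm (size 3F) 2 ⟩
    2 + size 3F                       ≤⟨ *-cancelˡ-≤ 2 doubled ⟩
    size 0F                           ≤⟨ m≤n+∣m-n∣ (size 0F) (size 3F) ⟩
    size 3F + _                       ≤⟨ +-monoʳ-≤ (size 3F) (equitable 0F 3F) ⟩
    size 3F + 1                       ∎)
    where
    open ≤-Reasoning
    size : Fin 4 → ℕ
    size i = length (colorClass coloring i)
    expand : ∀ s → 2 * (2 + s) ≡ 4 + 2 * s
    expand = solve-∀
    swap : ∀ m v → 4 + (m + v) ≡ m + (4 + v)
    swap = solve-∀
    doubled : 2 * (2 + size 3F) ≤ 2 * size 0F
    doubled = begin
      2 * (2 + size 3F)               ≡⟨ expand (size 3F) ⟩
      4 + 2 * size 3F                 ≡⟨ cong (4 +_) (double-classSize 3F) ⟩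
      4 + (n + colorCount col 3F)     ≡⟨ swap n (colorCount col 3F) ⟩
      n + (4 + colorCount col 3F)     ≤⟨ +-monoʳ-≤ n gap ⟩
      n + colorCount col 0F           ≡⟨ double-classSize 0F ⟨
      2 * size 0F                     ∎

-- Inserting a six-vertex block into an edge of color 0.

blockColors : Vec (Fin 4) 6
blockColors = 1F ∷ 2F ∷ 0F ∷ 0F ∷ 1F ∷ 2F ∷ []

-- 6F and 7F stand for the ends of the cut edge.
blockTable : Vec (Vec (Fin 8) 6) 4
blockTable = (1F ∷ 0F ∷ 2F ∷ 3F ∷ 7F ∷ 6F ∷ [])
           ∷ (0F ∷ 2F ∷ 1F ∷ 5F ∷ 4F ∷ 3F ∷ [])
           ∷ (2F ∷ 1F ∷ 0F ∷ 4F ∷ 3F ∷ 5F ∷ [])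
           ∷ (3F ∷ 4F ∷ 5F ∷ 0F ∷ 1F ∷ 2F ∷ [])
           ∷ []

-- The block is a triangular prism whose edge between `4F` and `5F`, of color 0, has been opened. It
-- has two vertices of each of the colors 0, 1, 2 and none of color 3. Block vertices are numbered
-- first, so old vertices shift by 6.
module Extension {k : ℕ} (S : Scheme k) where
  open Scheme S

  Cut : Fin 4 → Fin (2 + k) → Set
  Cut i w = i ≡ 0F × (w ≡ 0F ⊎ w ≡ 1F)

  cut? : ∀ i w → Dec (Cut i w)
  cut? i w = (i ≟ 0F) ×-dec ((w ≟ 0F) ⊎-dec (w ≟ 1F))

  Cut-μ : ∀ {i w} → Cut i w → Cut i (μ i w)
  Cut-μ (refl , inj₁ refl) = refl , inj₂ edge01
  Cut-μ (refl , inj₂ refl) = refl , inj₁ (trans (cong (μ 0F) (sym edge01)) (involutive 0F 0F))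

  -- Ensures that a kept edge is kept at both ends, as involutivity outside the block requires.
  Cut-μ⁻ : ∀ {i w} → Cut i (μ i w) → Cut i w
  Cut-μ⁻ {i} {w} c = subst (Cut i) (involutive i w) (Cut-μ c)

  old : Fin 4 → Fin (2 + k) → Fin (8 + k)
  old i w with cut? i w
  -- Mirrors the row of color 0 in `blockTable`. The old end of color 1 meets `5F` of color 2, and
  -- the old end of color 2 meets `4F` of color 1, so adjacent colors differ.
  ... | yes (_ , inj₁ _) = 5F
  ... | yes (_ , inj₂ _) = 4F
  ... | no _             = 6 ↑ʳ μ i w

  old-kept : ∀ {i w} → ¬ Cut i w → old i w ≡ 6 ↑ʳ μ i w
  old-kept {i} {w} ¬c with cut? i w
  ... | yes c = contradiction c ¬c
  ... | no _  = refl

  μ⁺ : Fin 4 → Fin (8 + k) → Fin (8 + k)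
  μ⁺ i = [ (λ b → lookup (lookup blockTable i) b ↑ˡ k) , old i ]′ ∘ splitAt 6

  col⁺ : Fin (8 + k) → Fin 4
  col⁺ = [ lookup blockColors , col ]′ ∘ splitAt 6

  involutive⁺ : ∀ i v → μ⁺ i (μ⁺ i v) ≡ v
  involutive⁺ i = +-elim 6 _
    -- This evaluates although `k` and `μ` are variables: from a block vertex, two steps use only
    -- the table and the cut half-edges.
    (from-yes (all? λ i → all? λ (b : Fin 6) → μ⁺ i (μ⁺ i (b ↑ˡ (2 + k))) ≟ b ↑ˡ (2 + k)) i)
    back
    where
    back : ∀ w → μ⁺ i (old i w) ≡ 6 ↑ʳ w
    back w with cut? i w
    ... | yes (refl , inj₁ refl) = refl
    ... | yes (refl , inj₂ refl) = refl
    ... | no ¬c = trans (old-kept (¬c ∘ Cut-μ⁻)) (cong (6 ↑ʳ_) (involutive i w))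

  fixed⁺ : ∀ v → μ⁺ (col⁺ v) v ≡ v
  fixed⁺ = +-elim 6 _
    (from-yes (all? λ (b : Fin 6) → μ⁺ (col⁺ (b ↑ˡ (2 + k))) (b ↑ˡ (2 + k)) ≟ b ↑ˡ (2 + k)))
    (λ w → trans (old-kept (¬cut w)) (cong (6 ↑ʳ_) (fixed w)))
    where
    -- The ends of the cut edge have colors 1 and 2, so redirecting color 0 there destroys no fixed
    -- point.
    ¬cut : ∀ w → ¬ Cut (col w) w
    ¬cut w (eq , inj₁ refl) = contradiction (trans (sym eq) col0) λ ()
    ¬cut w (eq , inj₂ refl) = contradiction (trans (sym eq) col1) λ ()

  distinct⁺ : ∀ v i j → μ⁺ i v ≡ μ⁺ j v → i ≡ j
  distinct⁺ = +-elim 6 _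
    (from-yes (all? λ (b : Fin 6) → all? λ i → all? λ j →
      (μ⁺ i (b ↑ˡ (2 + k)) ≟ μ⁺ j (b ↑ˡ (2 + k))) →-dec (i ≟ j)))
    separate
    where
    separate : ∀ w i j → old i w ≡ old j w → i ≡ j
    separate w i j eq with cut? i w | cut? j w
    ... | yes (refl , _)         | yes (refl , _)         = refl
    -- A redirected edge ends in the block, a kept one outside it.
    ... | yes (refl , inj₁ refl) | no _                   = contradiction eq λ ()
    ... | yes (refl , inj₂ refl) | no _                   = contradiction eq λ ()
    ... | no _                   | yes (refl , inj₁ refl) = contradiction eq λ ()
    ... | no _                   | yes (refl , inj₂ refl) = contradiction eq λ ()
    ... | no _                   | no _                   = distinct w i j (↑ʳ-injective 6 _ _ eq)

  proper⁺ : ∀ v i → col⁺ (μ⁺ i v) ≡ col⁺ v → i ≡ col⁺ v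
  proper⁺ = +-elim 6 _ inBlock outside
    where
    -- The colors of the old ends are known only through `col0` and `col1`; writing them out as
    -- constants lets the table be checked by evaluation.
    colors : Fin 8 → Fin 4
    colors = lookup (blockColors Vec.++ 1F ∷ 2F ∷ [])

    colors-correct : ∀ x → col⁺ (x ↑ˡ k) ≡ colors x
    colors-correct 0F = refl
    colors-correct 1F = refl
    colors-correct 2F = refl
    colors-correct 3F = refl
    colors-correct 4F = refl
    colors-correct 5F = refl
    colors-correct 6F = col0
    colors-correct 7F = col1

    inTable : ∀ b i → colors (lookup (lookup blockTable i) b) ≡ lookup blockColors b → i ≡ lookup blockColors b
    inTable = from-yes (all? λ b → all? λ i →
      (colors (lookup (lookup blockTable i) b) ≟ lookup blockColors b) →-dec (i ≟ lookup blockColors b))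

    inBlock : ∀ (b : Fin 6) i → col⁺ (μ⁺ i (b ↑ˡ (2 + k))) ≡ col⁺ (b ↑ˡ (2 + k)) → i ≡ col⁺ (b ↑ˡ (2 + k))
    inBlock b i eq rewrite splitAt-↑ˡ 6 b (2 + k) = inTable b i (trans (sym (colors-correct (lookup (lookup blockTable i) b))) eq)

    outside : ∀ w i → col⁺ (old i w) ≡ col w → i ≡ col w
    outside w i eq with cut? i w
    ... | yes (refl , inj₁ refl) = contradiction (trans eq col0) λ ()
    ... | yes (refl , inj₂ refl) = contradiction (trans eq col1) λ ()
    ... | no _                   = proper w i eq

  descends⁺ : ∀ v → ∃ λ i → μ⁺ i (suc v) Fin.< suc v
  -- The vertex in question is `suc v`, so five values of `v` give block vertices.
  descends⁺ = +-elim 5 _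
    (from-yes (all? λ (b : Fin 5) → any? λ i → μ⁺ i (suc (b ↑ˡ (2 + k))) <? suc (b ↑ˡ (2 + k))))
    outside
    where
    outside : ∀ w → ∃ λ i → old i w Fin.< 6 ↑ʳ w
    -- Both ends of the cut edge descend into the block along color 0; every other old vertex keeps
    -- its descent, shifted by 6.
    outside 0F            = 0F , ≤-refl
    outside 1F            = 0F , m≤n+m 5 2
    outside (suc (suc w)) =
      let i , lt = descends (suc w)
      in i , subst (Fin._< 8 ↑ʳ w) (sym (old-kept λ { (_ , inj₁ ()) ; (_ , inj₂ ()) })) (+-monoʳ-< 6 lt)

  extend : Scheme (6 + k)
  extend = record
    { μ        = μ⁺
    ; col      = col⁺
    ; isScheme = record
      { involutive = involutive⁺ ; fixed = fixed⁺ ; distinct = distinct⁺ ; proper = proper⁺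
      ; descends = descends⁺ ; edge01 = refl ; col0 = refl ; col1 = refl }
    }

  outsideCount : ∀ i → length (filter (λ v → col⁺ v ≟ i) (tabulate (6 ↑ʳ_))) ≡ colorCount col i
  outsideCount i = length-filter-tabulate (λ v → col⁺ v ≟ i) (6 ↑ʳ_)

  extend-count0 : colorCount col⁺ 0F ≡ 2 + colorCount col 0F
  extend-count0 = cong (2 +_) (outsideCount 0F)

  extend-count3 : colorCount col⁺ 3F ≡ colorCount col 3F
  extend-count3 = outsideCount 3F

-- Starting colorings and the induction on the order.

record GapScheme (g k : ℕ) : Set where
  field
    scheme : Scheme k
    gap    : g + colorCount (Scheme.col scheme) 3F ≤ colorCount (Scheme.col scheme) 0F

extendGap : ∀ {g k} → GapScheme g k → GapScheme (2 + g) (6 + k)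
extendGap {g} record { scheme = S ; gap = gap } = record
  { scheme = extend
  ; gap    = begin
      2 + g + colorCount col⁺ 3F   ≡⟨ cong (2 + g +_) extend-count3 ⟩
      2 + (g + colorCount col 3F)  ≤⟨ +-monoʳ-≤ 2 gap ⟩
      2 + colorCount col 0F        ≡⟨ extend-count0 ⟨
      colorCount col⁺ 0F           ∎
  }
  where
  open Scheme S using (col)
  open Extension S
  open ≤-Reasoning

weakenGap : ∀ h {g k} → GapScheme (h + g) k → GapScheme g k
weakenGap h {g} G = record
  { scheme = scheme
  ; gap    = ≤-trans (+-monoˡ-≤ _ (m≤n+m g h)) gap
  }
  where open GapScheme G

tableScheme : ∀ {k} (table : Vec (Vec (Fin (2 + k)) (2 + k)) 4) (cols : Vec (Fin 4) (2 + k)) →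
  {True (isScheme? (λ i → lookup (lookup table i)) (lookup cols))} → Scheme k
tableScheme table cols {valid} = record
  { μ = λ i → lookup (lookup table i) ; col = lookup cols ; isScheme = toWitness valid }

-- A coloring of the triangular prism.
base6 : GapScheme 2 4
base6 = record { scheme = tableScheme table cols ; gap = ≤-refl }
  where
  cols : Vec (Fin 4) 6
  cols = 1F ∷ 2F ∷ 0F ∷ 0F ∷ 2F ∷ 1F ∷ []
  table : Vec (Vec (Fin 6) 6) 4
  table = (1F ∷ 0F ∷ 2F ∷ 3F ∷ 5F ∷ 4F ∷ [])
        ∷ (0F ∷ 2F ∷ 1F ∷ 4F ∷ 3F ∷ 5F ∷ [])
        ∷ (2F ∷ 1F ∷ 0F ∷ 5F ∷ 4F ∷ 3F ∷ [])
        ∷ (4F ∷ 3F ∷ 5F ∷ 1F ∷ 0F ∷ 2F ∷ [])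
        ∷ []

base8 : GapScheme 0 6
base8 = record { scheme = tableScheme table cols ; gap = ≤-refl }
  where
  cols : Vec (Fin 4) 8
  cols = 1F ∷ 2F ∷ 3F ∷ 0F ∷ 3F ∷ 0F ∷ 2F ∷ 1F ∷ []
  table : Vec (Vec (Fin 8) 8) 4
  table = (1F ∷ 0F ∷ 6F ∷ 3F ∷ 7F ∷ 5F ∷ 2F ∷ 4F ∷ [])
        ∷ (0F ∷ 2F ∷ 1F ∷ 6F ∷ 5F ∷ 4F ∷ 3F ∷ 7F ∷ [])
        ∷ (4F ∷ 1F ∷ 5F ∷ 7F ∷ 0F ∷ 2F ∷ 6F ∷ 3F ∷ [])
        ∷ (5F ∷ 3F ∷ 2F ∷ 1F ∷ 4F ∷ 0F ∷ 7F ∷ 6F ∷ [])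
        ∷ []

base10 : GapScheme 2 8
base10 = record { scheme = tableScheme table cols ; gap = ≤-refl }
  where
  cols : Vec (Fin 4) 10
  cols = 1F ∷ 2F ∷ 0F ∷ 0F ∷ 2F ∷ 0F ∷ 3F ∷ 3F ∷ 1F ∷ 0F ∷ []
  table : Vec (Vec (Fin 10) 10) 4
  table = (1F ∷ 0F ∷ 2F ∷ 3F ∷ 7F ∷ 5F ∷ 8F ∷ 4F ∷ 6F ∷ 9F ∷ [])
        ∷ (0F ∷ 3F ∷ 6F ∷ 1F ∷ 9F ∷ 7F ∷ 2F ∷ 5F ∷ 8F ∷ 4F ∷ [])
        ∷ (9F ∷ 1F ∷ 7F ∷ 6F ∷ 4F ∷ 8F ∷ 3F ∷ 2F ∷ 5F ∷ 0F ∷ [])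
        ∷ (5F ∷ 2F ∷ 1F ∷ 4F ∷ 3F ∷ 0F ∷ 6F ∷ 7F ∷ 9F ∷ 8F ∷ [])
        ∷ []

-- The order is `16 + m * 2`. Orders 16, 18 and 20 represent all even residues modulo 6; they arise
-- from orders 10, 6 and 8 by one, two and two extensions, with gaps 4, 6 and 4.
gapScheme : ∀ m → GapScheme 4 (14 + m * 2)
gapScheme 0                   = extendGap base10
gapScheme 1                   = weakenGap 2 (extendGap (extendGap base6))
gapScheme 2                   = extendGap (extendGap base8)
gapScheme (suc (suc (suc m))) = weakenGap 2 (extendGap (gapScheme m))

theorem6p2 : (n : ℕ) → 2 ∣ n → 16 ≤ n →
    Σ (Graph n) λ G →
    Connected G × Cubic G × Σ (TotalColoring 4 G) λ c → ¬ Equitable c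
theorem6p2 .(q * 2) (divides q refl) 16≤n with m≤n⇒∃[o]m+o≡n (*-cancelʳ-≤ 8 q 2 16≤n)
-- Here `q` is `8 + m`, and `(8 + m) * 2` computes to the order `2 + (14 + m * 2)` of `gapScheme m`.
... | m , refl = graph , connected , cubic , coloring , gap⇒non-equitable gap
  where
  open GapScheme (gapScheme m)
  open Coloring scheme
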